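{- If there exists a polynomial-time algorithm for the restriction of the $\mathrm{Schrijver}$ problem to colorings of $S(n,k)$ with $n=4k$, then there exists a polynomial-time algorithm for the $\mathrm{Schrijver}(n,k,m)$ problem where $m=\lfloor n/2\rfloor-2k+1$ (algorithms being in the black-box input model).
   Context: Write $[n]=\{1,\ldots,n\}$. A subset of $[n]$ is stable if it contains no two consecutive elements and does not contain both $1$ and $n$. Let $\binom{[n]}{k}_{\mathrm{stab}}$ be the family of stable $k$-subsets of $[n]$. For positive integers $n\ge 2k$, the Schrijver graph $S(n,k)$ has vertex set $\binom{[n]}{k}_{\mathrm{stab}}$, with two sets adjacent if and only if they are disjoint. For a function $m=m(n,k)$, the search problem $\mathrm{Schrijver}(n,k,m)$ is: given positive integers $n,k$ with $n\ge 2k$ and a (not necessarily proper) coloring $c:\binom{[n]}{k}_{\mathrm{stab}}\to[m]$ with $m=m(n,k)$ colors, find a monochromatic edge of $S(n,k)$, i.e., $A,B\in\binom{[n]}{k}_{\mathrm{stab}}$ with $A\cap B=\emptyset$ and $c(A)=c(B)$. The problem $\mathrm{Schrijver}$ is $\mathrm{Schrijver}(n,k,n-2k+1)$. In the black-box input model, the coloring $c$ is given by an oracle which returns $c(A)$ when queried on a vertex $A$. An algorithm is polynomial-time if its running time (including oracle queries) is polynomial in $n$. -}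

module Defs where

open import Data.Bool using (Bool; true; false; if_then_else_)
open import Data.Fin using (Fin; toℕ)
open import Data.Fin.Subset using (Subset; _∈_; _∩_; Empty; ∣_∣)
open import Data.Nat using (ℕ; zero; suc; _+_; _*_; _∸_; _^_; _≤_; _<_; _≡ᵇ_; ⌊_/2⌋)
open import Data.Product using (Σ; ∃; ∃-syntax; _×_; _,_)
open import Data.Refinement using (Refinement; Refinement-syntax; value)
open import Data.Vec using ([]; _∷_)
open import Relation.Binary.PropositionalEquality using (_≡_; _≢_)
open import Relation.Nullary using (¬_)

------------------------------------------------------------------------
-- Schrijver graphs

-- The element i of {1,…,n} is the i : Fin n with toℕ i equal to i - 1.

Stable : ∀ {n} → Subset n → Set
Stable {n} A =
    (∀ (i j : Fin n) → toℕ j ≡ suc (toℕ i) → ¬ (i ∈ A × j ∈ A))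
  × (∀ (i j : Fin n) → toℕ i ≡ 0 → suc (toℕ j) ≡ n → ¬ (i ∈ A × j ∈ A))

-- The refinement proof is irrelevant, so a vertex is determined by its
-- underlying set, and a function on vertices depends on that set only.

Vertex : ℕ → ℕ → Set
Vertex n k = [ A ∈ Subset n ∣ (Stable A × ∣ A ∣ ≡ k) ]

Adjacent : ∀ {n k} → Vertex n k → Vertex n k → Set
Adjacent A B = Empty (value A ∩ value B)

Coloring : ℕ → ℕ → ℕ → Set
Coloring n k m = Vertex n k → Fin m

MonochromaticEdge : ∀ {n k m} → Coloring n k m → Vertex n k → Vertex n k → Set
MonochromaticEdge c A B = Adjacent A B × c A ≡ c B

schrijverColors : ℕ → ℕ → ℕ
schrijverColors n k = n ∸ 2 * k + 1

-- ⌊n/2⌋ - 2k + 1 can be negative when n ≥ 2k.  The truncated subtraction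
-- is performed last, so that the set of colors is then empty.

halfColors : ℕ → ℕ → ℕ
halfColors n k = (⌊ n /2⌋ + 1) ∸ 2 * k

------------------------------------------------------------------------
-- Oracle algorithms

-- Algorithms are programs of Jones' WHILE language (imperative programs
-- over binary trees, whose polynomial-time decidable problems are exactly
-- those of Turing machines), extended with an instruction querying an
-- oracle.  Trees are immutable and shared, so copying one takes unit time;
-- the only test is for nil, and comparing two trees has to be programmed.

infixr 6 _∙_

data Tree : Set where
  nil : Tree
  _∙_ : Tree → Tree → Tree

head : Tree → Tree
head nil     = nil
head (s ∙ t) = s

tail : Tree → Tree
tail nil     = nil
tail (s ∙ t) = t

Var : Set
Var = ℕ

data Expr : Set where
  var   : Var → Expr
  `nil  : Expr
  `cons : Expr → Expr → Expr
  `head : Expr → Expr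
  `tail : Expr → Expr

infix  5 _:=_ _:=query_
infixr 4 _⨾_

data Program : Set where
  skip      : Program
  _:=_      : Var → Expr → Program
  _:=query_ : Var → Expr → Program
  _⨾_       : Program → Program → Program
  `if       : Expr → Program → Program → Program
  `while    : Expr → Program → Program

Store : Set
Store = Var → Tree

infixl 7 _[_↦_]

_[_↦_] : Store → Var → Tree → Store
(σ [ x ↦ t ]) y = if y ≡ᵇ x then t else σ y

⟦_⟧ : Expr → Store → Tree
⟦ var x ⟧     σ = σ x
⟦ `nil ⟧      σ = nil
⟦ `cons e f ⟧ σ = ⟦ e ⟧ σ ∙ ⟦ f ⟧ σ
⟦ `head e ⟧   σ = head (⟦ e ⟧ σ)
⟦ `tail e ⟧   σ = tail (⟦ e ⟧ σ)

cost : Expr → ℕ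
cost (var x)     = 1
cost `nil        = 1
cost (`cons e f) = suc (cost e + cost f)
cost (`head e)   = suc (cost e)
cost (`tail e)   = suc (cost e)

-- O q a means that the oracle answers a to the query q.

Oracle : Set₁
Oracle = Tree → Tree → Set

-- Exec O p σ t τ means that p, started in the store σ with oracle O, halts
-- after time t in the store τ.  Execution is deterministic whenever the
-- oracle gives at most one answer to each query; a program making a query
-- which has no answer gets stuck, and does not halt.

data Exec (O : Oracle) : Program → Store → ℕ → Store → Set where
  skip  : ∀ {σ} →
          Exec O skip σ 1 σ
  assign : ∀ {σ x e} →
          Exec O (x := e) σ (suc (cost e)) (σ [ x ↦ ⟦ e ⟧ σ ])
  query : ∀ {σ x e a} → O (⟦ e ⟧ σ) a →
          Exec O (x :=query e) σ (suc (cost e)) (σ [ x ↦ a ])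
  seq   : ∀ {p q σ τ υ s t} → Exec O p σ s τ → Exec O q τ t υ →
          Exec O (p ⨾ q) σ (s + t) υ
  then′ : ∀ {e p q σ τ t} → ⟦ e ⟧ σ ≢ nil → Exec O p σ t τ →
          Exec O (`if e p q) σ (suc (cost e) + t) τ
  else′ : ∀ {e p q σ τ t} → ⟦ e ⟧ σ ≡ nil → Exec O q σ t τ →
          Exec O (`if e p q) σ (suc (cost e) + t) τ
  stop  : ∀ {e p σ} → ⟦ e ⟧ σ ≡ nil →
          Exec O (`while e p) σ (suc (cost e)) σ
  loop  : ∀ {e p σ τ υ s t} → ⟦ e ⟧ σ ≢ nil →
          Exec O p σ s τ → Exec O (`while e p) τ t υ →
          Exec O (`while e p) σ (suc (cost e) + (s + t)) υ

-- Input and output are passed in variable 0.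

initial : Tree → Store
initial t = (λ _ → nil) [ 0 ↦ t ]

output : Store → Tree
output σ = σ 0

------------------------------------------------------------------------
-- Polynomial-time algorithms in the black-box model

-- Numbers are given in unary, as running times are measured in n.

encodeℕ : ℕ → Tree
encodeℕ zero    = nil
encodeℕ (suc n) = nil ∙ encodeℕ n

encodeBool : Bool → Tree
encodeBool false = nil
encodeBool true  = nil ∙ nil

encodeSubset : ∀ {n} → Subset n → Tree
encodeSubset []      = nil
encodeSubset (b ∷ A) = encodeBool b ∙ encodeSubset A

encodeVertex : ∀ {n k} → Vertex n k → Tree
encodeVertex A = encodeSubset (value A)

-- Only vertices may be queried.

blackBox : ∀ {n k m} → Coloring n k m → Oracle
blackBox {n} {k} c q a =
  Σ (Vertex n k) λ A → q ≡ encodeVertex A × a ≡ encodeℕ (toℕ (c A))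

SolvesWithin : ∀ {n k m} → Program → Coloring n k m → ℕ → Set
SolvesWithin {n} {k} p c T =
  ∃[ t ] ∃[ σ ]
    Exec (blackBox c) p (initial (encodeℕ n ∙ encodeℕ k)) t σ
  × t ≤ T
  × Σ (Vertex n k) λ A → Σ (Vertex n k) λ B →
      output σ ≡ encodeVertex A ∙ encodeVertex B × MonochromaticEdge c A B

-- There is a polynomial-time algorithm for Schrijver(n,k,m) restricted to
-- the pairs (n,k) satisfying R.  As n ≥ 1, a running time is polynomial in
-- n if and only if it is at most a * n ^ d for some constants a and d.

PolynomialTime : (R : ℕ → ℕ → Set) (m : ℕ → ℕ → ℕ) → Set
PolynomialTime R m =
  Σ Program λ p → Σ ℕ λ a → Σ ℕ λ d →
    ∀ n k → 0 < n → 0 < k → 2 * k ≤ n → R n k →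
    (c : Coloring n k (m n k)) → SolvesWithin p c (a * n ^ d)

-- Write n = 4k′ + r with r < 4.  If k > k′ there are no colors, hence no
-- coloring, as S(n,k) has a vertex.  Otherwise, keeping the first k elements
-- of a stable k′-subset of {1,…,4k′} gives a stable k-subset of {1,…,n}, and
-- disjoint sets stay disjoint.  A coloring of S(n,k) pulls back to one of
-- S(4k′,k′), which is allowed 4k′ - 2k′ + 1 ≥ ⌊n/2⌋ - 2k + 1 colors.  The
-- given algorithm is run on the pullback, each query being truncated before
-- it is passed to the oracle, and the edge it finds is truncated likewise.

module Submission where

open import Defs
open import Data.Bool using (Bool; true; false)
open import Data.Empty using (⊥-elim)
open import Data.Fin using (Fin; zero; suc; toℕ; inject≤)
open import Data.Fin.Properties using (toℕ-injective; toℕ-inject≤; toℕ<n; ¬Fin0)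
open import Data.Fin.Subset using (Subset; _∈_; _∩_; Empty; ∣_∣; ⊥; _⊆_)
open import Data.Fin.Subset.Properties using (∣⊥∣≡0; ∉⊥; x∈p∩q⁻; x∈p∩q⁺)
open import Data.Irrelevant using ([_])
open import Data.Nat using (ℕ; zero; suc; _+_; _*_; _∸_; _^_; _≤_; _<_; _≡ᵇ_; ⌊_/2⌋; z≤n; s≤s; s≤s⁻¹; _≤?_; _/_; _%_; NonZero; >-nonZero)
open import Data.Nat.DivMod using (m≡m%n+[m/n]*n; m%n<n)
open import Data.Nat.Properties
open import Data.Nat.Solver using (module +-*-Solver)
open +-*-Solver using (solve; con; _:+_; _:*_) renaming (_:=_ to _⊜_)
open import Data.Product using (Σ; ∃-syntax; _×_; _,_; proj₁; proj₂)
open import Data.Refinement using (value; _,_)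
open import Data.Unit using (⊤; tt)
open import Data.Vec using ([]; _∷_; _++_; here; there)
open import Function using (_∘_)
open import Relation.Binary.PropositionalEquality using (_≡_; _≢_; refl; sym; trans; cong; cong₂; subst)
open import Relation.Nullary using (¬_; yes; no)

-- Vertices of Schrijver graphs

keepFirst : ∀ {n} → ℕ → Subset n → Subset n
keepFirst k       []          = []
keepFirst k       (false ∷ A) = false ∷ keepFirst k A
keepFirst zero    (true ∷ A)  = false ∷ keepFirst zero A
keepFirst (suc k) (true ∷ A)  = true ∷ keepFirst k A

keepFirst-⊆ : ∀ {n} k (A : Subset n) → keepFirst k A ⊆ A
keepFirst-⊆ k       (false ∷ A) (there i∈) = there (keepFirst-⊆ k A i∈)
keepFirst-⊆ zero    (true ∷ A)  (there i∈) = there (keepFirst-⊆ zero A i∈)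
keepFirst-⊆ (suc k) (true ∷ A)  here       = here
keepFirst-⊆ (suc k) (true ∷ A)  (there i∈) = there (keepFirst-⊆ k A i∈)

∣keepFirst∣ : ∀ {n} k (A : Subset n) → k ≤ ∣ A ∣ → ∣ keepFirst k A ∣ ≡ k
∣keepFirst∣ zero    []          k≤ = refl
∣keepFirst∣ k       (false ∷ A) k≤ = ∣keepFirst∣ k A k≤
∣keepFirst∣ zero    (true ∷ A)  k≤ = ∣keepFirst∣ zero A z≤n
∣keepFirst∣ (suc k) (true ∷ A)  k≤ = cong suc (∣keepFirst∣ k A (s≤s⁻¹ k≤))

Stable-⊆ : ∀ {n} {A B : Subset n} → A ⊆ B → Stable B → Stable A
Stable-⊆ A⊆B (inner , outer) =
    (λ i j j≡1+i (i∈ , j∈) → inner i j j≡1+i (A⊆B i∈ , A⊆B j∈))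
  , (λ i j i≡0 1+j≡n (i∈ , j∈) → outer i j i≡0 1+j≡n (A⊆B i∈ , A⊆B j∈))

pad : ∀ {n} r → Subset n → Subset (n + r)
pad r A = A ++ ⊥

-- The appended block is `⊥`, so every member lies among the first `n` positions.
∈-pad⁻ : ∀ {n} r (A : Subset n) {i} → i ∈ pad r A →
         ∃[ j ] toℕ j ≡ toℕ i × j ∈ A
∈-pad⁻ r []      i∈   = ⊥-elim (∉⊥ i∈)
∈-pad⁻ r (_ ∷ A) here = zero , refl , here
∈-pad⁻ r (_ ∷ A) (there i∈) with ∈-pad⁻ r A i∈
... | j , j≡i , j∈ = suc j , cong suc j≡i , there j∈

∣pad∣ : ∀ {n} r (A : Subset n) → ∣ pad r A ∣ ≡ ∣ A ∣
∣pad∣ r []          = ∣⊥∣≡0 r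
∣pad∣ r (false ∷ A) = ∣pad∣ r A
∣pad∣ r (true ∷ A)  = cong suc (∣pad∣ r A)

-- Only the wraparound condition is delicate, as padding moves the last position. A member there
-- comes from an index n + r - 1 below `n`, so `r` is 0 and the condition is the one on `A`.
Stable-pad : ∀ {n} r {A : Subset n} → Stable A → Stable (pad r A)
Stable-pad {n} r {A} (inner , outer) = inner′ , outer′
  where
  inner′ : ∀ i j → toℕ j ≡ suc (toℕ i) → ¬ (i ∈ pad r A × j ∈ pad r A)
  inner′ i j j≡1+i (i∈ , j∈) with ∈-pad⁻ r A i∈ | ∈-pad⁻ r A j∈
  ... | i′ , i′≡i , i′∈ | j′ , j′≡j , j′∈ =
    inner i′ j′ (trans j′≡j (trans j≡1+i (cong suc (sym i′≡i)))) (i′∈ , j′∈)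

  outer′ : ∀ i j → toℕ i ≡ 0 → suc (toℕ j) ≡ n + r →
           ¬ (i ∈ pad r A × j ∈ pad r A)
  outer′ i j i≡0 1+j≡n+r (i∈ , j∈) with ∈-pad⁻ r A i∈ | ∈-pad⁻ r A j∈
  ... | i′ , i′≡i , i′∈ | j′ , j′≡j , j′∈ =
    outer i′ j′ (trans i′≡i i≡0) (≤-antisym (toℕ<n j′) n≤1+j′) (i′∈ , j′∈)
    where
    n≤1+j′ : n ≤ suc (toℕ j′)
    n≤1+j′ = subst (n ≤_) (sym (trans (cong suc j′≡j) 1+j≡n+r)) (m≤m+n n r)

Empty-pad-∩ : ∀ {n} r {A B : Subset n} →
              Empty (A ∩ B) → Empty (pad r A ∩ pad r B)
Empty-pad-∩ r {A} {B} A∩B=∅ (i , i∈) with x∈p∩q⁻ (pad r A) (pad r B) i∈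
... | i∈A , i∈B with ∈-pad⁻ r A i∈A | ∈-pad⁻ r B i∈B
... | j , j≡i , j∈A | l , l≡i , l∈B =
  A∩B=∅ (j , x∈p∩q⁺ (j∈A , subst (_∈ B) (toℕ-injective (trans l≡i (sym j≡i))) l∈B))

Empty-∩-⊆ : ∀ {n} {A A′ B B′ : Subset n} → A ⊆ A′ → B ⊆ B′ →
            Empty (A′ ∩ B′) → Empty (A ∩ B)
Empty-∩-⊆ {A = A} {B = B} A⊆A′ B⊆B′ A′∩B′=∅ (i , i∈) with x∈p∩q⁻ A B i∈
... | i∈A , i∈B = A′∩B′=∅ (i , x∈p∩q⁺ (A⊆A′ i∈A , B⊆B′ i∈B))

truncate : ∀ {n} r k → Subset n → Subset (n + r)
truncate r k A = pad r (keepFirst k A)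

truncateVertex : ∀ {n l} r k → k ≤ l → Vertex n l → Vertex (n + r) k
truncateVertex r k k≤l (A , [ p ]) = truncate r k A ,
  [ ( Stable-pad r (Stable-⊆ (keepFirst-⊆ k A) (proj₁ p))
    , trans (∣pad∣ r (keepFirst k A))
            (∣keepFirst∣ k A (≤-trans k≤l (≤-reflexive (sym (proj₂ p))))) ) ]

truncateVertex-Adjacent : ∀ {n l} r k (k≤l : k ≤ l) (A B : Vertex n l) → Adjacent A B →
                          Adjacent (truncateVertex r k k≤l A) (truncateVertex r k k≤l B)
truncateVertex-Adjacent r k k≤l A B =
  Empty-pad-∩ r ∘ Empty-∩-⊆ (keepFirst-⊆ k (value A)) (keepFirst-⊆ k (value B))

-- Existence of a vertex

alternating : ∀ k r → Subset (k * 2 + r)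
alternating zero    r = ⊥
-- The length is `k * 2 + r` because `suc k * 2` unfolds to two successors, one for each bit added
-- here.
alternating (suc k) r = true ∷ false ∷ alternating k r

∈-alternating⁻ : ∀ k r {i} → i ∈ alternating k r → ∃[ q ] toℕ i ≡ 2 * q × q < k
∈-alternating⁻ zero    r i∈   = ⊥-elim (∉⊥ i∈)
∈-alternating⁻ (suc k) r here = 0 , refl , s≤s z≤n
∈-alternating⁻ (suc k) r (there (there i∈)) with ∈-alternating⁻ k r i∈
... | q , i≡2q , q<k = suc q , trans (cong (2 +_) i≡2q) (sym (*-suc 2 q)) , s≤s q<k

∣alternating∣ : ∀ k r → ∣ alternating k r ∣ ≡ k
∣alternating∣ zero    r = ∣⊥∣≡0 r
∣alternating∣ (suc k) r = cong suc (∣alternating∣ k r)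

-- All indices are even, so no two are consecutive, and each is at most 2k - 2, short of the last
-- position.
Stable-alternating : ∀ k r → Stable (alternating k r)
Stable-alternating k r = inner , outer
  where
  inner : ∀ i j → toℕ j ≡ suc (toℕ i) → ¬ (i ∈ alternating k r × j ∈ alternating k r)
  inner i j j≡1+i (i∈ , j∈) with ∈-alternating⁻ k r i∈ | ∈-alternating⁻ k r j∈
  ... | p , i≡2p , _ | q , j≡2q , _ =
    even≢odd q p (trans (sym j≡2q) (trans j≡1+i (cong suc i≡2p)))

  outer : ∀ i j → toℕ i ≡ 0 → suc (toℕ j) ≡ k * 2 + r →
          ¬ (i ∈ alternating k r × j ∈ alternating k r)
  outer i j _ 1+j≡n (_ , j∈) with ∈-alternating⁻ k r j∈
  ... | q , j≡2q , q<k = <-irrefl refl (begin-strict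
    suc (toℕ j)  ≡⟨ cong suc j≡2q ⟩
    suc (2 * q)  ≡⟨ cong suc (*-comm 2 q) ⟩
    suc (q * 2)  <⟨ *-monoˡ-≤ 2 q<k ⟩
    k * 2        ≤⟨ m≤m+n (k * 2) r ⟩
    k * 2 + r    ≡⟨ 1+j≡n ⟨
    suc (toℕ j)  ∎)
    where open ≤-Reasoning

vertex : ∀ n k → 2 * k ≤ n → Vertex n k
vertex n k 2k≤n = subst (λ m → Vertex m k) k*2+r≡n
  (alternating k (n ∸ 2 * k) , [ (Stable-alternating k _ , ∣alternating∣ k _) ])
  where
  k*2+r≡n : k * 2 + (n ∸ 2 * k) ≡ n
  k*2+r≡n = trans (cong (_+ (n ∸ 2 * k)) (*-comm k 2)) (m+[n∸m]≡n 2k≤n)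

-- Numbers of colors

⌊k*4+r/2⌋≤1+k*2 : ∀ k {r} → r < 4 → ⌊ k * 4 + r /2⌋ ≤ suc (k * 2)
⌊k*4+r/2⌋≤1+k*2 zero    r<4 = ⌊n/2⌋-mono (s≤s⁻¹ r<4)
⌊k*4+r/2⌋≤1+k*2 (suc k) r<4 = s≤s (s≤s (⌊k*4+r/2⌋≤1+k*2 k r<4))

⌊4k+r/2⌋≤1+2k : ∀ k {r} → r < 4 → ⌊ 4 * k + r /2⌋ ≤ suc (2 * k)
⌊4k+r/2⌋≤1+2k k {r} r<4 rewrite *-comm 4 k | *-comm 2 k = ⌊k*4+r/2⌋≤1+k*2 k r<4

-- The half may reach 2l + 1, which makes 2l + 2 before the subtraction. Taking away 1, which is at
-- most `2 * k` since `0 < k`, brings this down to the 2l + 1 colors of S(4l,l).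
halfColors≤schrijverColors : ∀ l {r k} → r < 4 → 0 < k →
                             halfColors (4 * l + r) k ≤ schrijverColors (4 * l) l
halfColors≤schrijverColors l {r} {k} r<4 0<k = begin
  (⌊ 4 * l + r /2⌋ + 1) ∸ 2 * k  ≤⟨ ∸-mono (+-monoˡ-≤ 1 (⌊4k+r/2⌋≤1+2k l r<4)) (≤-trans 0<k (m≤m+n k _)) ⟩
  2 * l + 1                      ≡⟨ cong (_+ 1) (m+n∸n≡m (2 * l) (2 * l)) ⟨
  2 * l + 2 * l ∸ 2 * l + 1      ≡⟨ cong (λ m → m ∸ 2 * l + 1) (*-distribʳ-+ l 2 2) ⟨
  4 * l ∸ 2 * l + 1              ∎
  where open ≤-Reasoning

halfColors≡0 : ∀ l {r k} → r < 4 → l < k → halfColors (4 * l + r) k ≡ 0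
halfColors≡0 l {r} {k} r<4 l<k = m≤n⇒m∸n≡0 (begin
  ⌊ 4 * l + r /2⌋ + 1  ≤⟨ +-monoˡ-≤ 1 (⌊4k+r/2⌋≤1+2k l r<4) ⟩
  suc (2 * l) + 1      ≡⟨ +-comm (suc (2 * l)) 1 ⟩
  2 + 2 * l            ≡⟨ *-suc 2 l ⟨
  2 * suc l            ≤⟨ *-monoʳ-≤ 2 l<k ⟩
  2 * k                ∎)
  where open ≤-Reasoning

-- Total correctness of programs

-- `Exec` carries the exact time, whereas `T` is an upper bound, so that branches of different
-- lengths can share one specification.
record Run (O : Oracle) (p : Program) (σ : Store) (T : ℕ) (Q : Store → Set) : Set where
  constructor run
  field
    {time}  : ℕ
    {final} : Store
    exec    : Exec O p σ time final
    time≤   : time ≤ T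
    post    : Q final

private
  variable
    O     : Oracle
    p q   : Program
    σ τ υ : Store
    Q R   : Store → Set
    S T   : ℕ
    x     : Var
    e     : Expr

within : S ≤ T → Run O p σ S Q → Run O p σ T Q
within S≤T (run ex t≤ post) = run ex (≤-trans t≤ S≤T) post

weaken : (∀ {τ} → Q τ → R τ) → Run O p σ T Q → Run O p σ T R
weaken Q⇒R (run ex t≤ post) = run ex t≤ (Q⇒R post)

run-skip : Q σ → Run O skip σ 1 Q
run-skip = run skip ≤-refl

run-assign : Q (σ [ x ↦ ⟦ e ⟧ σ ]) → Run O (x := e) σ (suc (cost e)) Q
run-assign = run assign ≤-refl

run-query : ∀ {a} → O (⟦ e ⟧ σ) a → Q (σ [ x ↦ a ]) →
            Run O (x :=query e) σ (suc (cost e)) Q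
run-query ans = run (query ans) ≤-refl

infixr 4 _⨟_

_⨟_ : Run O p σ S R → (∀ {τ} → R τ → Run O q τ T Q) → Run O (p ⨾ q) σ (S + T) Q
run ex s≤ post ⨟ next with next post
... | run ex′ t≤ post′ = run (seq ex ex′) (+-mono-≤ s≤ t≤) post′

-- Unlike _⨟_, this keeps the updated store explicit, so that lookups in it
-- compute.
infixr 4 assign⨟_

assign⨟_ : Run O q (σ [ x ↦ ⟦ e ⟧ σ ]) T Q → Run O (x := e ⨾ q) σ (suc (cost e) + T) Q
assign⨟_ {e = e} (run ex t≤ post) = run (seq assign ex) (+-monoʳ-≤ (suc (cost e)) t≤) post

run-then : ⟦ e ⟧ σ ≢ nil → Run O p σ T Q → Run O (`if e p q) σ (suc (cost e) + T) Q
run-then {e = e} e≢nil (run ex t≤ post) = run (then′ e≢nil ex) (+-monoʳ-≤ (suc (cost e)) t≤) post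

run-else : ⟦ e ⟧ σ ≡ nil → Run O q σ T Q → Run O (`if e p q) σ (suc (cost e) + T) Q
run-else {e = e} e≡nil (run ex t≤ post) = run (else′ e≡nil ex) (+-monoʳ-≤ (suc (cost e)) t≤) post

run-stop : ⟦ e ⟧ σ ≡ nil → Q σ → Run O (`while e p) σ (suc (cost e)) Q
run-stop e≡nil = run (stop e≡nil) ≤-refl

-- The postcondition of the body is a run of the remaining loop, so a loop is verified by recursion
-- on the data it consumes.
run-loop : ⟦ e ⟧ σ ≢ nil → Run O p σ S (λ τ → Run O (`while e p) τ T Q) →
           Run O (`while e p) σ (suc (cost e) + (S + T)) Q
run-loop {e = e} e≢nil (run ex s≤ (run ex′ t≤ post)) =
  run (loop e≢nil ex ex′) (+-monoʳ-≤ (suc (cost e)) (+-mono-≤ s≤ t≤)) post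

cons≢nil : ∀ {s t u} → u ≡ s ∙ t → u ≢ nil
cons≢nil refl ()

-- The truncation of a set

current kept count limit padding : Var
current = 0
kept    = 1
count   = 2
limit   = 3
padding = 4

-- Only the variables below limit serve as scratch space.
Preserved : Store → Store → Set
Preserved σ τ = ∀ x → τ (3 + x) ≡ σ (3 + x)

countDown : Program
countDown =
  `if (`head (var current))
    (`if (var count)
      (count := `tail (var count))
      (current := `cons `nil (`tail (var current))))
    skip

keepLoop : Program
keepLoop = `while (var current)
  (countDown ⨾
   kept := `cons (`head (var current)) (var kept) ⨾
   current := `tail (var current))

reverseLoop : Program
reverseLoop = `while (var kept)
  (current := `cons (`head (var kept)) (var current) ⨾
   kept := `tail (var kept))

-- The first loop leaves the bits in reverse order on the stack `kept`. Seeding `current` with the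
-- padding before they are popped back appends the padding.
truncateProgram : Program
truncateProgram =
  kept := `nil ⨾
  count := var limit ⨾
  keepLoop ⨾
  current := var padding ⨾
  reverseLoop

revOnto : Tree → Tree → Tree
revOnto nil     t = t
revOnto (s ∙ u) t = revOnto u (s ∙ t)

length : Tree → ℕ
length nil     = 0
length (s ∙ t) = suc (length t)

-- A false bit and a unit of a unary number are both `nil`, so `r` in unary already is the block to
-- append.
encodeSubset-⊥ : ∀ r → encodeSubset (⊥ {r}) ≡ encodeℕ r
encodeSubset-⊥ zero    = refl
encodeSubset-⊥ (suc r) = cong (nil ∙_) (encodeSubset-⊥ r)

length-revOnto : ∀ {n} (A : Subset n) t →
                 length (revOnto (encodeSubset A) t) ≡ n + length t
length-revOnto []      t = refl
length-revOnto (b ∷ A) t = trans (length-revOnto A _) (+-suc _ (length t))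

-- The two reversals cancel. The accumulator `t` is there for the induction; the program starts it
-- at `nil`.
revOnto-revOnto : ∀ {n} r (A : Subset n) t →
                  revOnto (revOnto (encodeSubset A) t) (encodeℕ r) ≡ revOnto t (encodeSubset (pad r A))
revOnto-revOnto r []      t = cong (revOnto t) (sym (encodeSubset-⊥ r))
revOnto-revOnto r (b ∷ A) t = revOnto-revOnto r A (encodeBool b ∙ t)

-- A common postcondition for the three paths through `countDown`, so that the proof of the loop
-- needs no case distinction.
record KeepStep {n} (k : ℕ) (b : Bool) (A : Subset n) (σ τ : Store) : Set where
  field
    {newCount}  : ℕ
    {newBit}    : Bool
    keepFirst-≡ : keepFirst k (b ∷ A) ≡ newBit ∷ keepFirst newCount A
    current-≡   : τ current ≡ encodeBool newBit ∙ encodeSubset A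
    kept-≡      : τ kept ≡ σ kept
    count-≡     : τ count ≡ encodeℕ newCount
    preserved   : Preserved σ τ

run-countDown : ∀ {n} k b (A : Subset n) →
                σ current ≡ encodeSubset (b ∷ A) → σ count ≡ encodeℕ k →
                Run O countDown σ 10 (KeepStep k b A σ)
run-countDown k false A cur≡ cnt≡ = within (≤ᵇ⇒≤ 4 10 tt)
  (run-else (cong head cur≡) (run-skip record
    { keepFirst-≡ = refl ; current-≡ = cur≡ ; kept-≡ = refl ; count-≡ = cnt≡ ; preserved = λ _ → refl }))
-- The slowest path, which clears a bit: 3 + 2 + 5 = 10.
run-countDown zero true A cur≡ cnt≡ =
  run-then (cons≢nil (cong head cur≡)) (run-else cnt≡ (run-assign record
    { keepFirst-≡ = refl ; current-≡ = cong (λ t → nil ∙ tail t) cur≡ ; kept-≡ = refl ; count-≡ = cnt≡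
    ; preserved = λ _ → refl }))
run-countDown (suc k) true A cur≡ cnt≡ = within (≤ᵇ⇒≤ 8 10 tt)
  (run-then (cons≢nil (cong head cur≡)) (run-then (cons≢nil cnt≡) (run-assign record
    { keepFirst-≡ = refl ; current-≡ = cur≡ ; kept-≡ = refl ; count-≡ = cong tail cnt≡
    ; preserved = λ _ → refl })))

-- A pass costs 2 + 10 + 5 + 3 = 20, the last test 2. The bound `n * 20 + 2` unfolds in step with
-- the recursion on `A`, so no arithmetic is left to do.
run-keepLoop : ∀ {n} k (A : Subset n) t →
               σ current ≡ encodeSubset A → σ kept ≡ t → σ count ≡ encodeℕ k →
               Run O keepLoop σ (n * 20 + 2) λ τ →
                 τ kept ≡ revOnto (encodeSubset (keepFirst k A)) t × Preserved σ τ
run-keepLoop k []      t cur≡ kept≡ cnt≡ = run-stop cur≡ (kept≡ , λ _ → refl)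
run-keepLoop k (b ∷ A) t cur≡ kept≡ cnt≡ =
  run-loop (cons≢nil cur≡) (run-countDown k b A cur≡ cnt≡ ⨟ λ s →
    let open KeepStep s in
    assign⨟ run-assign (weaken
      (λ (kept≡′ , preserved′) →
          trans kept≡′ (cong (λ B → revOnto (encodeSubset B) t) (sym keepFirst-≡))
        , λ x → trans (preserved′ x) (preserved x))
      (run-keepLoop newCount A (encodeBool newBit ∙ t)
        (cong tail current-≡) (cong₂ _∙_ (cong head current-≡) (trans kept-≡ kept≡)) count-≡)))

run-reverseLoop : ∀ u t → σ kept ≡ u → σ current ≡ t →
                  Run O reverseLoop σ (length u * 10 + 2) λ τ →
                    τ current ≡ revOnto u t × Preserved σ τ
run-reverseLoop nil     t kept≡ cur≡ = run-stop kept≡ (cur≡ , λ _ → refl)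
run-reverseLoop (s ∙ u) t kept≡ cur≡ =
  run-loop (cons≢nil kept≡) (assign⨟ run-assign
    (run-reverseLoop u (s ∙ t) (cong tail kept≡) (cong₂ _∙_ (cong head kept≡) cur≡)))

-- The loops take 20 and 10 per element; three assignments and two final tests cost 2 each. The
-- padding is never traversed, so its length does not enter.
truncateTime : ℕ → ℕ
truncateTime n = 30 * n + 10

run-truncate : ∀ {n} r k (A : Subset n) →
               σ current ≡ encodeSubset A → σ limit ≡ encodeℕ k → σ padding ≡ encodeℕ r →
               Run O truncateProgram σ (truncateTime n) λ τ →
                 τ current ≡ encodeSubset (truncate r k A) × Preserved σ τ
run-truncate {n = n} r k A cur≡ lim≡ pad≡ = within (≤-reflexive time≡)
  (assign⨟ assign⨟ run-keepLoop k A nil cur≡ refl lim≡ ⨟ λ (kept≡ , preserved) →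
   assign⨟ weaken
     (λ (cur≡′ , preserved′) → trans cur≡′ (revOnto-revOnto r (keepFirst k A) nil)
                             , λ x → trans (preserved′ x) (preserved x))
     (run-reverseLoop (revOnto (encodeSubset (keepFirst k A)) nil) (encodeℕ r)
       kept≡ (trans (preserved 1) pad≡)))
  where
  time≡ : 2 + (2 + (n * 20 + 2 + (2 + (length (revOnto (encodeSubset (keepFirst k A)) nil) * 10 + 2)))) ≡ 30 * n + 10
  time≡ rewrite length-revOnto (keepFirst k A) nil =
    solve 1 (λ n → con 2 :+ (con 2 :+ (n :* con 20 :+ con 2 :+ (con 2 :+ ((n :+ con 0) :* con 10 :+ con 2))))
                   ⊜ con 30 :* n :+ con 10) refl n

-- Programs run with the variables shifted and the queries truncated

-- Variables 0 to 4 belong to the truncation, so those of the simulated program move up by 5.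
shiftExpr : Expr → Expr
shiftExpr (var x)     = var (5 + x)
shiftExpr `nil        = `nil
shiftExpr (`cons e f) = `cons (shiftExpr e) (shiftExpr f)
shiftExpr (`head e)   = `head (shiftExpr e)
shiftExpr (`tail e)   = `tail (shiftExpr e)

translate : Program → Program
translate skip           = skip
translate (x := e)       = 5 + x := shiftExpr e
translate (x :=query e)  = current := shiftExpr e ⨾ truncateProgram ⨾ 5 + x :=query var current
translate (p ⨾ q)        = translate p ⨾ translate q
translate (`if e p q)    = `if (shiftExpr e) (translate p) (translate q)
translate (`while e p)   = `while (shiftExpr e) (translate p)

record Represents (r k : ℕ) (σ τ : Store) : Set where
  constructor represents
  field
    limit-≡   : τ limit ≡ encodeℕ k
    padding-≡ : τ padding ≡ encodeℕ r
    shift-≡   : ∀ x → τ (5 + x) ≡ σ x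
open Represents

cost-shift : ∀ e → cost (shiftExpr e) ≡ cost e
cost-shift (var x)     = refl
cost-shift `nil        = refl
cost-shift (`cons e f) = cong suc (cong₂ _+_ (cost-shift e) (cost-shift f))
cost-shift (`head e)   = cong suc (cost-shift e)
cost-shift (`tail e)   = cong suc (cost-shift e)

⟦⟧-shift : ∀ {r k} → Represents r k σ τ → ∀ e → ⟦ shiftExpr e ⟧ τ ≡ ⟦ e ⟧ σ
⟦⟧-shift rep (var x)     = shift-≡ rep x
⟦⟧-shift rep `nil        = refl
⟦⟧-shift rep (`cons e f) = cong₂ _∙_ (⟦⟧-shift rep e) (⟦⟧-shift rep f)
⟦⟧-shift rep (`head e)   = cong head (⟦⟧-shift rep e)
⟦⟧-shift rep (`tail e)   = cong tail (⟦⟧-shift rep e)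

Represents-preserved : ∀ {r k} → Represents r k σ τ → Preserved τ υ → Represents r k σ υ
Represents-preserved rep preserved = represents
  (trans (preserved 0) (limit-≡ rep))
  (trans (preserved 1) (padding-≡ rep))
  (λ x → trans (preserved (2 + x)) (shift-≡ rep x))

Represents-update : ∀ {r k s t} x → Represents r k σ τ → t ≡ s →
                    Represents r k (σ [ x ↦ s ]) (τ [ 5 + x ↦ t ])
Represents-update {σ = σ} {τ = τ} {s = s} {t} x rep t≡s =
  represents (limit-≡ rep) (padding-≡ rep) shifted
  where
  shifted : ∀ y → (τ [ 5 + x ↦ t ]) (5 + y) ≡ (σ [ x ↦ s ]) y
  -- The test `5 + y ≡ᵇ 5 + x` reduces to this one, so both updates are settled together.
  shifted y with y ≡ᵇ x
  ... | true  = t≡s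
  ... | false = shift-≡ rep y

-- By induction on the execution: instructions are simulated one by one, and only queries become
-- slower. Answers agree, as `O′` gives on the truncated set what `O` gives on the set.
run-translate : ∀ {O O′ : Oracle} {n p t} r k →
  (∀ {q a} → O q a → Σ (Subset n) λ A → q ≡ encodeSubset A × O′ (encodeSubset (truncate r k A)) a) →
  Exec O p σ t υ → Represents r k σ τ →
  Run O′ (translate p) τ (t * (3 + truncateTime n)) (Represents r k υ)
run-translate {O = O} {O′} {n} r k answers = go
  where
  L : ℕ
  L = truncateTime n

  scale : ∀ {c c′ s t} → c′ ≡ c → s ≤ t * (3 + L) → suc c′ + s ≤ (suc c + t) * (3 + L)
  scale {c} {_} {s} {t} refl s≤ = begin
    suc c + s                        ≤⟨ +-mono-≤ (m≤m*n (suc c) (3 + L)) s≤ ⟩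
    suc c * (3 + L) + t * (3 + L)    ≡⟨ *-distribʳ-+ (3 + L) (suc c) t ⟨
    (suc c + t) * (3 + L)            ∎
    where open ≤-Reasoning

  scale₀ : ∀ {c c′} → c′ ≡ c → suc c′ ≤ suc c * (3 + L)
  scale₀ {c} refl = m≤m*n (suc c) (3 + L)

  -- Besides the original cost there is the truncation and 2 for querying `current`. The factor
  -- `3 + L` is exact when `c` is 0.
  scale-query : ∀ {c c′} → c′ ≡ c → suc c′ + (L + 2) ≤ suc c * (3 + L)
  scale-query {c} refl = begin
    suc c + (L + 2)          ≡⟨ solve 2 (λ c l → con 1 :+ c :+ (l :+ con 2) ⊜ con 3 :+ l :+ c) refl c L ⟩
    3 + L + c                ≤⟨ +-monoʳ-≤ (3 + L) (m≤m*n c (3 + L)) ⟩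
    3 + L + c * (3 + L)      ∎
    where open ≤-Reasoning

  go : ∀ {p σ τ t υ} → Exec O p σ t υ → Represents r k σ τ →
       Run O′ (translate p) τ (t * (3 + L)) (Represents r k υ)
  go skip rep = within (scale₀ refl) (run-skip rep)
  go (assign {x = x} {e}) rep =
    within (scale₀ (cost-shift e)) (run-assign (Represents-update x rep (⟦⟧-shift rep e)))
  go {τ = τ} (query {x = x} {e} ans) rep with answers ans
  ... | A , q≡ , ans′ = within (scale-query (cost-shift e))
    (assign⨟ run-truncate r k A (trans (⟦⟧-shift rep e) q≡) (limit-≡ rep) (padding-≡ rep) ⨟
      λ (cur≡ , preserved) →
        run-query (subst (λ q → O′ q _) (sym cur≡) ans′)
                  (Represents-update x (Represents-preserved {τ = τ} rep preserved) refl))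
  go (seq {s = s} {t} ex ex′) rep =
    within (≤-reflexive (sym (*-distribʳ-+ (3 + L) s t))) (go ex rep ⨟ go ex′)
  go (then′ {e = e} e≢nil ex) rep =
    within (scale (cost-shift e) ≤-refl) (run-then (e≢nil ∘ trans (sym (⟦⟧-shift rep e))) (go ex rep))
  go (else′ {e = e} e≡nil ex) rep =
    within (scale (cost-shift e) ≤-refl) (run-else (trans (⟦⟧-shift rep e) e≡nil) (go ex rep))
  go (stop {e = e} e≡nil) rep =
    within (scale₀ (cost-shift e)) (run-stop (trans (⟦⟧-shift rep e) e≡nil) rep)
  go (loop {e = e} {s = s} {t} e≢nil ex ex′) rep =
    within (scale (cost-shift e) (≤-reflexive (sym (*-distribʳ-+ (3 + L) s t))))
      (run-loop (e≢nil ∘ trans (sym (⟦⟧-shift rep e))) (weaken (go ex′) (go ex rep)))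

-- The reduction

-- Turns padding = n and variable 5 = (0 , 0) into n % 4 and the input
-- (4 (n / 4) , n / 4) of the translated program.  As tail nil = nil, the
-- guard holds exactly when at least 4 is left.
divideLoop : Program
divideLoop = `while (`tail (`tail (`tail (var padding))))
  (padding := `tail (`tail (`tail (`tail (var padding)))) ⨾
   5 := `cons (`cons `nil (`cons `nil (`cons `nil (`cons `nil (`head (var 5))))))
              (`cons `nil (`tail (var 5))))

-- Variable 5 is variable 0 of the simulated program, hence both its input and its output. Variable
-- 6 is untouched by `truncateProgram` and keeps the first vertex once the simulation has ended.
reduction : Program → Program
reduction p =
  limit := `tail (var 0) ⨾
  padding := `head (var 0) ⨾
  5 := `cons `nil `nil ⨾
  divideLoop ⨾
  translate p ⨾
  current := `head (var 5) ⨾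
  truncateProgram ⨾
  6 := var current ⨾
  current := `tail (var 5) ⨾
  truncateProgram ⨾
  0 := `cons (var 6) (var current)

-- `i` counts the passes made and `l` those to come; a pass costs 5 + 6 + 16 = 27. The variables
-- from 6 on are tracked because the simulated program must find them `nil`.
run-divideLoop : ∀ l i {r} → r < 4 →
  σ 4 ≡ encodeℕ (l * 4 + r) → σ 5 ≡ encodeℕ (i * 4) ∙ encodeℕ i →
  Run O divideLoop σ (l * 27 + 5) λ τ →
    τ 4 ≡ encodeℕ r × τ 5 ≡ encodeℕ ((l + i) * 4) ∙ encodeℕ (l + i) ×
    τ limit ≡ σ limit × (∀ x → τ (6 + x) ≡ σ (6 + x))
run-divideLoop zero i r<4 4≡ 5≡ =
  run-stop (trans (cong (tail ∘ tail ∘ tail) 4≡) (short r<4)) (4≡ , 5≡ , refl , λ _ → refl)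
  where
  short : ∀ {r} → r < 4 → tail (tail (tail (encodeℕ r))) ≡ nil
  short (s≤s z≤n)                   = refl
  short (s≤s (s≤s z≤n))             = refl
  short (s≤s (s≤s (s≤s z≤n)))       = refl
  short (s≤s (s≤s (s≤s (s≤s z≤n)))) = refl
run-divideLoop (suc l) i r<4 4≡ 5≡ =
  run-loop (cons≢nil (cong (tail ∘ tail ∘ tail) 4≡)) (assign⨟ run-assign (weaken
    (λ (4≡′ , 5≡′ , rest) →
      4≡′ , trans 5≡′ (cong (λ m → encodeℕ (m * 4) ∙ encodeℕ m) (+-suc l i)) , rest)
    (run-divideLoop l (suc i) r<4
      (cong (tail ∘ tail ∘ tail ∘ tail) 4≡)
      (cong (λ t → (nil ∙ nil ∙ nil ∙ nil ∙ head t) ∙ (nil ∙ tail t)) 5≡))))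

run-reduction : ∀ {p l r k T} → r < 4 → 0 < k → (k≤l : k ≤ l) →
  ((c : Coloring (4 * l) l (schrijverColors (4 * l) l)) → SolvesWithin p c T) →
  (c : Coloring (4 * l + r) k (halfColors (4 * l + r) k)) →
  SolvesWithin (reduction p) c
    (10 + (l * 27 + 5 + (T * (3 + truncateTime (4 * l)) +
      (3 + (truncateTime (4 * l) + (2 + (3 + (truncateTime (4 * l) + 4))))))))
run-reduction {p} {l} {r} {k} {T} r<4 0<k k≤l solves c = unpack whole
  where
  m≤ : halfColors (4 * l + r) k ≤ schrijverColors (4 * l) l
  m≤ = halfColors≤schrijverColors l r<4 0<k

  f : Vertex (4 * l) l → Vertex (4 * l + r) k
  f = truncateVertex r k k≤l

  -- `inject≤` keeps the number of a color, so the answers of the oracle are passed on unchanged.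
  pullback : Coloring (4 * l) l (schrijverColors (4 * l) l)
  pullback A = inject≤ (c (f A)) m≤

  answers : ∀ {q a} → blackBox pullback q a →
    Σ (Subset (4 * l)) λ A → q ≡ encodeSubset A × blackBox c (encodeSubset (truncate r k A)) a
  answers (A , q≡ , a≡) =
    value A , q≡ , f A , refl , trans a≡ (cong encodeℕ (toℕ-inject≤ (c (f A)) m≤))

  Solved : Store → Set
  Solved σ = Σ (Vertex (4 * l + r) k) λ A → Σ (Vertex (4 * l + r) k) λ B →
    output σ ≡ encodeVertex A ∙ encodeVertex B × MonochromaticEdge c A B

  unpack : ∀ {T} → Run (blackBox c) (reduction p) (initial (encodeℕ (4 * l + r) ∙ encodeℕ k)) T Solved →
           SolvesWithin (reduction p) c T
  unpack (run ex t≤ post) = _ , _ , ex , t≤ , post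

  finish : ∀ {τ} A B → MonochromaticEdge pullback A B →
    τ 5 ≡ encodeVertex A ∙ encodeVertex B → τ limit ≡ encodeℕ k → τ padding ≡ encodeℕ r →
    Run (blackBox c)
      (current := `head (var 5) ⨾ truncateProgram ⨾ 6 := var current ⨾
       current := `tail (var 5) ⨾ truncateProgram ⨾ 0 := `cons (var 6) (var current))
      τ (3 + (truncateTime (4 * l) + (2 + (3 + (truncateTime (4 * l) + 4))))) Solved
  finish A B (adj , same) 5≡ lim≡ pad≡ =
    assign⨟ run-truncate r k (value A) (cong head 5≡) lim≡ pad≡ ⨟ λ (A≡ , preserved) →
    assign⨟ assign⨟ run-truncate r k (value B)
        (cong tail (trans (preserved 2) 5≡))
        (trans (preserved 0) lim≡) (trans (preserved 1) pad≡) ⨟ λ (B≡ , preserved′) →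
    run-assign
      -- Offsets start at `limit`: `preserved′ 3` concerns variable 6, where the truncation of `A`
      -- was saved.
      ( f A , f B , cong₂ _∙_ (trans (preserved′ 3) A≡) B≡
      , truncateVertex-Adjacent r k k≤l A B adj
      , toℕ-injective (trans (sym (toℕ-inject≤ (c (f A)) m≤))
                             (trans (cong toℕ same) (toℕ-inject≤ (c (f B)) m≤))))

  whole : Run (blackBox c) (reduction p) (initial (encodeℕ (4 * l + r) ∙ encodeℕ k)) _ Solved
  whole with solves pullback
  ... | t , υ , ex , t≤T , A , B , out≡ , edge =
    assign⨟ assign⨟ assign⨟
    run-divideLoop l 0 r<4 (cong (λ m → encodeℕ (m + r)) (*-comm 4 l)) refl ⨟
      λ {τ} (4≡ , 5≡ , 3≡ , rest) →
    within (*-monoˡ-≤ (3 + truncateTime (4 * l)) t≤T)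
      (run-translate r k answers ex (represents 3≡ 4≡ λ
        { zero    → trans 5≡ (cong₂ _∙_ (cong encodeℕ (trans (cong (_* 4) (+-identityʳ l)) (*-comm l 4)))
                                        (cong encodeℕ (+-identityʳ l)))
        ; (suc x) → rest x })) ⨟ λ rep →
    finish A B edge (trans (shift-≡ rep 0) out≡) (limit-≡ rep) (padding-≡ rep)

-- Polynomial bound on the running time

time-bound : ∀ l r a d → 0 < l →
  10 + (l * 27 + 5 + (a * (4 * l) ^ d * (3 + truncateTime (4 * l)) +
    (3 + (truncateTime (4 * l) + (2 + (3 + (truncateTime (4 * l) + 4)))))))
  ≤ (43 * a + 134) * (4 * l + r) ^ suc d
time-bound l r a d 0<l = begin
  10 + (l * 27 + 5 + (a * m ^ d * (3 + (30 * m + 10)) + (3 + (30 * m + 10 + (2 + (3 + (30 * m + 10 + 4)))))))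
    ≡⟨ solve 3 (λ l x m → con 10 :+ (l :* con 27 :+ con 5 :+ (x :* (con 3 :+ (con 30 :* m :+ con 10)) :+
                 (con 3 :+ (con 30 :* m :+ con 10 :+ (con 2 :+ (con 3 :+ (con 30 :* m :+ con 10 :+ con 4)))))))
               ⊜ x :* (con 30 :* m :+ con 13) :+ (con 60 :* m :+ con 27 :* l :+ con 47)) refl l (a * m ^ d) m ⟩
  a * m ^ d * (30 * m + 13) + (60 * m + 27 * l + 47)
    -- Since `m`, `l` and 1 are at most `n`, each summand becomes a multiple of `n`; then 43 = 30 +
    -- 13 and 134 = 60 + 27 + 47.
    ≤⟨ +-mono-≤ (*-mono-≤ (*-monoʳ-≤ a (^-monoˡ-≤ d m≤n)) (+-mono-≤ (*-monoʳ-≤ 30 m≤n) (*-monoʳ-≤ 13 1≤n)))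
                (+-mono-≤ (+-mono-≤ (*-monoʳ-≤ 60 m≤n) (*-monoʳ-≤ 27 (≤-trans (m≤m+n l _) m≤n))) (*-monoʳ-≤ 47 1≤n)) ⟩
  a * n ^ d * (30 * n + 13 * n) + (60 * n + 27 * n + 47 * n)
    ≡⟨ solve 3 (λ a n x → a :* x :* (con 30 :* n :+ con 13 :* n) :+ (con 60 :* n :+ con 27 :* n :+ con 47 :* n)
               ⊜ con 43 :* a :* (n :* x) :+ con 134 :* (n :* con 1)) refl a n (n ^ d) ⟩
  43 * a * (n * n ^ d) + 134 * (n * 1)
    ≤⟨ +-monoʳ-≤ (43 * a * (n * n ^ d)) (*-monoʳ-≤ 134 (*-monoʳ-≤ n (m^n>0 n d))) ⟩
  43 * a * (n * n ^ d) + 134 * (n * n ^ d)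
    ≡⟨ *-distribʳ-+ (n * n ^ d) (43 * a) 134 ⟨
  (43 * a + 134) * (n * n ^ d) ∎
  where
  open ≤-Reasoning
  m n : ℕ
  m = 4 * l
  n = 4 * l + r

  m≤n : m ≤ n
  m≤n = m≤m+n m r

  1≤n : 1 ≤ n
  1≤n = ≤-trans 0<l (≤-trans (m≤m+n l _) m≤n)

  instance
    n≢0 : NonZero n
    n≢0 = >-nonZero 1≤n

n≡4[n/4]+n%4 : ∀ n → n ≡ 4 * (n / 4) + n % 4
n≡4[n/4]+n%4 n = trans (m≡m%n+[m/n]*n n 4)
  (trans (+-comm (n % 4) _) (cong (_+ n % 4) (*-comm (n / 4) 4)))

SolvesWithin-mono : ∀ {n k m} {c : Coloring n k m} → S ≤ T → SolvesWithin p c S → SolvesWithin p c T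
SolvesWithin-mono S≤T (t , σ , ex , t≤S , solved) = t , σ , ex , ≤-trans t≤S S≤T , solved

theorem1p3 : PolynomialTime (λ n k → n ≡ 4 * k) schrijverColors →
    PolynomialTime (λ n k → ⊤) halfColors
theorem1p3 (p , a , d , solves) =
  -- A step of `p` may cost a truncation, linear in `n`, so the exponent rises by one.
  reduction p , 43 * a + 134 , suc d , λ n k _ 0<k 2k≤n _ →
    reduce k (n / 4) (m%n<n n 4) (n≡4[n/4]+n%4 n) 0<k 2k≤n
  where
  -- Quotient and remainder are generalized to `l` and `r`; with `n / 4` in place of `l` the
  -- equation could not be matched with `refl`.
  reduce : ∀ {n} k l {r} → r < 4 → n ≡ 4 * l + r → 0 < k → 2 * k ≤ n →
           (c : Coloring n k (halfColors n k)) →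
           SolvesWithin (reduction p) c ((43 * a + 134) * n ^ suc d)
  reduce k l {r} r<4 refl 0<k 2k≤n c with k ≤? l
  ... | no  k≰l = ⊥-elim (¬Fin0 (subst Fin (halfColors≡0 l r<4 (≰⇒> k≰l)) (c (vertex _ k 2k≤n))))
  ... | yes k≤l = SolvesWithin-mono (time-bound l r a d 0<l) (run-reduction r<4 0<k k≤l
                    (solves (4 * l) l (≤-trans 0<l (m≤m+n l _)) 0<l (*-monoˡ-≤ l (≤ᵇ⇒≤ 2 4 tt)) refl) c)
    where
    0<l : 0 < l
    0<l = ≤-trans 0<k k≤l
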